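{- Let $R$ be a graph on $s$ vertices having exactly $\ell$ vertices of degree one, and such that no connected component of $R$ is isomorphic to $K_1$ or to $K_2$. Then \[ \phi(R)\le 2^{s}+(s-\ell-2)2^{s-\ell-1}. \]
   Context: Graphs are finite and simple. For a graph $R$ and nonempty $I\subseteq V(R)$, $\delta_I=\min\{d_R(x):x\in I\}$, and the fixed loss of $R$ is \[ \phi(R)=\sum_{\substack{I \text{ independent in } R\\ I\neq\emptyset}}\bigl(2^{\delta_I}-1\bigr). \] -}

module Defs where

open import Data.Nat using (ℕ; zero; suc; _+_; _*_; _∸_; _^_; _⊓_)
open import Data.Bool using (Bool; true; false; if_then_else_; _∧_; not)
open import Data.Fin using (Fin)
open import Data.List using (List; []; _∷_; map; filter; length; allFin; foldr; concatMap)
open import Data.Nat.ListAction using (sum)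
open import Data.Bool.ListAction using (and)
open import Data.Vec using (Vec; lookup; toList)
import Data.Vec as Vec
open import Data.Product using (Σ; _×_; _,_)
open import Relation.Nullary using (¬_)
open import Relation.Binary.PropositionalEquality using (_≡_; _≢_)
open import Data.Nat using (_≟_)
open import Function.Definitions using (Injective)

record Graph (s : ℕ) : Set where
  field
    adj    : Fin s → Fin s → Bool
    sym    : ∀ u v → adj u v ≡ adj v u
    irrefl : ∀ v → adj v v ≡ false
open Graph public

deg : ∀ {s} → Graph s → Fin s → ℕ
deg {s} R v = sum (map (λ u → if adj R v u then 1 else 0) (allFin s))

numDegOne : ∀ {s} → Graph s → ℕ
numDegOne {s} R = length (filter (λ v → deg R v ≟ 1) (allFin s))

allSubsets : (s : ℕ) → List (Vec Bool s)
allSubsets zero    = Vec.[] ∷ []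
allSubsets (suc s) = concatMap (λ I → (true Vec.∷ I) ∷ (false Vec.∷ I) ∷ []) (allSubsets s)

members : ∀ {s} → Vec Bool s → List (Fin s)
members {s} I = filter (λ v → Data.Bool._≟_ (lookup I v) true) (allFin s)

independent : ∀ {s} → Graph s → Vec Bool s → Bool
independent R I = and (concatMap (λ u → map (λ v → not (adj R u v)) (members I)) (members I))

nonempty : ∀ {s} → Vec Bool s → Bool
nonempty I with members I
... | []    = false
... | _ ∷ _ = true

-- minimum of a nonempty list (value on [] is irrelevant; only used for nonempty lists)
minList : List ℕ → ℕ
minList []       = 0
minList (x ∷ xs) = foldr _⊓_ x xs

δ : ∀ {s} → Graph s → Vec Bool s → ℕ
δ R I = minList (map (deg R) (members I))

φ : ∀ {s} → Graph s → ℕ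
φ {s} R = sum (map (λ I → if independent R I ∧ nonempty I then 2 ^ δ R I ∸ 1 else 0) (allSubsets s))

data Reachable {s} (R : Graph s) : Fin s → Fin s → Set where
  here : ∀ {v} → Reachable R v v
  step : ∀ {u v w} → adj R u v ≡ true → Reachable R v w → Reachable R u w

ComponentIsoK : ∀ {s} → Graph s → Fin s → ℕ → Set
ComponentIsoK {s} R v n =
  Σ (Fin n → Fin s) λ f →
    Injective _≡_ _≡_ f
    × (∀ u → Reachable R v u → Σ (Fin n) λ i → f i ≡ u)
    × (∀ i → Reachable R v (f i))
    × (∀ i j → (adj R (f i) (f j) ≡ true → i ≢ j) × (i ≢ j → adj R (f i) (f j) ≡ true))

{-# OPTIONS --safe #-}

-- Let L be the set of leaves, C its complement, c = |C|.  An independent set meeting L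
-- contributes at most 1.  Order L; the neighbour n of the first leaf of such a set is outside
-- the set, and n ∉ L because there is no K₂ component, so adding n gives a dependent set with
-- the same trace on L.  Hence at most half of the 2^s − 2^c sets meeting L are independent.
--
-- An independent set I ⊆ C is charged to a vertex x ∈ I of minimum degree.  If x has ℓ(x) leaf
-- neighbours, then I ∖ {x} avoids its deg x − ℓ(x) neighbours in C, so x receives at most
-- 2^{deg x} · 2^{c − 1 − deg x + ℓ(x)} = 2^{c−1} · 2^{ℓ(x)}.  Since Σ ℓ(x) ≤ ℓ, convexity gives
-- Σ_{x ∈ C} 2^{ℓ(x)} ≤ c − 1 + 2^ℓ, and the two contributions add up to the bound.
module Submission where

open import Defs
open import Data.Nat using (ℕ; _∸_; _^_)
open import Data.Fin using (Fin)
open import Relation.Nullary using (¬_)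
open import Relation.Binary.PropositionalEquality using (_≡_)

module Counting where

  open import Data.Bool as Bool using (Bool; true; false; if_then_else_; _∧_; _∨_; not)
  open import Data.Bool.ListAction using (and; any; or)
  open import Data.Fin using (zero; suc)
  import Data.Fin as Fin
  open import Data.List using (List; []; _∷_; map; filter; length; allFin; concatMap; foldr)
  open import Data.List.Properties using (map-tabulate; map-cong; map-cong-local; length-tabulate)
  open import Data.List.Membership.Propositional using (_∈_)
  open import Data.List.Membership.Propositional.Properties
    using (∈-map⁺; ∈-map⁻; ∈-filter⁺; ∈-filter⁻; ∈-allFin; ∈-concatMap⁺; foldr-selective)
  open import Data.List.Relation.Unary.All using (All; []; _∷_)
  import Data.List.Relation.Unary.All as All
  open import Data.List.Relation.Unary.All.Properties using (all-filter)
  open import Data.List.Relation.Unary.Any using (here; there)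
  import Data.List.Relation.Unary.Any as Any
  open import Data.Nat using (zero; suc; _+_; _*_; _≤_; z≤n; s≤s; _⊓_; _≟_)
  open import Data.Nat.ListAction using (sum; product)
  open import Data.Nat.Properties hiding (_≟_)
  open import Data.Nat.Tactic.RingSolver using (solve-∀)
  open import Data.Product using (_×_; _,_; ∃; ∃₂; proj₂)
  open import Data.Sum using (inj₁; inj₂)
  open import Data.Vec using (Vec; lookup; updateAt)
  import Data.Vec as Vec
  open import Data.Vec.Properties using (lookup∘updateAt; lookup∘updateAt′)
  open import Function using (_∘_)
  open import Relation.Nullary using (yes; no; does; contradiction)
  open import Relation.Nullary.Decidable using (¬?; dec-true; dec-false)
  open import Relation.Unary using (Decidable)
  open import Relation.Binary.PropositionalEquality as ≡
    using (_≢_; refl; cong; cong₂; subst; module ≡-Reasoning)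

  private variable
    A B : Set
    s : ℕ

  𝟙 : Bool → ℕ
  𝟙 b = if b then 1 else 0

  ∑ : List A → (A → ℕ) → ℕ
  ∑ xs f = sum (map f xs)

  ∏ : List A → (A → ℕ) → ℕ
  ∏ xs f = product (map f xs)

  -- Sums and products over lists

  ∑-mono : (xs : List A) {f g : A → ℕ} → (∀ {x} → x ∈ xs → f x ≤ g x) → ∑ xs f ≤ ∑ xs g
  ∑-mono []       f≤g = z≤n
  ∑-mono (x ∷ xs) f≤g = +-mono-≤ (f≤g (here refl)) (∑-mono xs (f≤g ∘ there))

  ∑-cong : (xs : List A) {f g : A → ℕ} → (∀ x → f x ≡ g x) → ∑ xs f ≡ ∑ xs g
  ∑-cong []       f≡g = refl
  ∑-cong (x ∷ xs) f≡g = cong₂ _+_ (f≡g x) (∑-cong xs f≡g)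

  ∑-+ : (xs : List A) (f g : A → ℕ) → ∑ xs (λ x → f x + g x) ≡ ∑ xs f + ∑ xs g
  ∑-+ []       f g = refl
  ∑-+ (x ∷ xs) f g = ≡.trans (cong (f x + g x +_) (∑-+ xs f g)) (lem (f x) (g x) _ _)
    where
    lem : ∀ a b c d → a + b + (c + d) ≡ a + c + (b + d)
    lem = solve-∀

  ∑-*ˡ : (xs : List A) (k : ℕ) (f : A → ℕ) → ∑ xs (λ x → k * f x) ≡ k * ∑ xs f
  ∑-*ˡ []       k f = ≡.sym (*-zeroʳ k)
  ∑-*ˡ (x ∷ xs) k f = ≡.trans (cong (k * f x +_) (∑-*ˡ xs k f)) (≡.sym (*-distribˡ-+ k (f x) _))

  ∑-zero : (xs : List A) → ∑ xs (λ _ → 0) ≡ 0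
  ∑-zero []       = refl
  ∑-zero (x ∷ xs) = ∑-zero xs

  ∑-one : (xs : List A) → ∑ xs (λ _ → 1) ≡ length xs
  ∑-one []       = refl
  ∑-one (x ∷ xs) = cong suc (∑-one xs)

  ∑-swap : (xs : List A) (ys : List B) (f : A → B → ℕ) →
    ∑ xs (λ x → ∑ ys (f x)) ≡ ∑ ys (λ y → ∑ xs (λ x → f x y))
  ∑-swap []       ys f = ≡.sym (∑-zero ys)
  ∑-swap (x ∷ xs) ys f =
    ≡.trans (cong (∑ ys (f x) +_) (∑-swap xs ys f)) (≡.sym (∑-+ ys (f x) _))

  ∑-∈ : {xs : List A} {x : A} (f : A → ℕ) → x ∈ xs → f x ≤ ∑ xs f
  ∑-∈ f (here refl) = m≤m+n _ _
  ∑-∈ f (there x∈)  = ≤-trans (∑-∈ f x∈) (m≤n+m _ _)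

  ∑-∈₂ : {xs : List A} {x y : A} (f : A → ℕ) → x ≢ y → x ∈ xs → y ∈ xs → f x + f y ≤ ∑ xs f
  ∑-∈₂ f x≢y (here refl) (here refl) = contradiction refl x≢y
  ∑-∈₂ f x≢y (here refl) (there y∈)  = +-monoʳ-≤ _ (∑-∈ f y∈)
  ∑-∈₂ f x≢y (there x∈)  (here refl) =
    ≤-trans (≤-reflexive (+-comm (f _) (f _))) (+-monoʳ-≤ _ (∑-∈ f x∈))
  ∑-∈₂ f x≢y (there x∈)  (there y∈)  = ≤-trans (∑-∈₂ f x≢y x∈ y∈) (m≤n+m _ _)

  ∑-𝟙-positive : (xs : List A) (p : A → Bool) → ∑ xs (𝟙 ∘ p) ≢ 0 → ∃ λ x → p x ≡ true
  ∑-𝟙-positive []       p ≢0 = contradiction refl ≢0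
  ∑-𝟙-positive (x ∷ xs) p ≢0 with p x in eq
  ... | true  = x , eq
  ... | false = ∑-𝟙-positive xs p ≢0

  length-filter-𝟙 : {P : A → Set} (P? : Decidable P) (xs : List A) →
    length (filter P? xs) ≡ ∑ xs (𝟙 ∘ does ∘ P?)
  length-filter-𝟙 P? []       = refl
  length-filter-𝟙 P? (x ∷ xs) with does (P? x)
  ... | true  = cong suc (length-filter-𝟙 P? xs)
  ... | false = length-filter-𝟙 P? xs

  ∑-filter-≤ : {P : A → Set} (P? : Decidable P) (xs : List A) (f : A → ℕ) →
    ∑ (filter P? xs) f ≤ ∑ xs f
  ∑-filter-≤ P? []       f = z≤n
  ∑-filter-≤ P? (x ∷ xs) f with does (P? x)
  ... | true  = +-monoʳ-≤ (f x) (∑-filter-≤ P? xs f)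
  ... | false = ≤-trans (∑-filter-≤ P? xs f) (m≤n+m _ _)

  ∏-mono : (xs : List A) {f g : A → ℕ} → (∀ x → f x ≤ g x) → ∏ xs f ≤ ∏ xs g
  ∏-mono []       f≤g = ≤-refl
  ∏-mono (x ∷ xs) f≤g = *-mono-≤ (f≤g x) (∏-mono xs f≤g)

  ∏-* : (xs : List A) (f g : A → ℕ) → ∏ xs (λ x → f x * g x) ≡ ∏ xs f * ∏ xs g
  ∏-* []       f g = refl
  ∏-* (x ∷ xs) f g = ≡.trans (cong (f x * g x *_) (∏-* xs f g)) (lem (f x) (g x) _ _)
    where
    lem : ∀ a b c d → a * b * (c * d) ≡ a * c * (b * d)
    lem = solve-∀

  ∏-2^ : (xs : List A) (f : A → ℕ) → ∏ xs (λ x → 2 ^ f x) ≡ 2 ^ ∑ xs f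
  ∏-2^ []       f = refl
  ∏-2^ (x ∷ xs) f =
    ≡.trans (cong (2 ^ f x *_) (∏-2^ xs f)) (≡.sym (^-distribˡ-+-* 2 (f x) (∑ xs f)))

  ∏-positive : (xs : List A) {f : A → ℕ} → (∀ x → 1 ≤ f x) → 1 ≤ ∏ xs f
  ∏-positive []       1≤f = ≤-refl
  ∏-positive (x ∷ xs) 1≤f = *-mono-≤ (1≤f x) (∏-positive xs 1≤f)

  -- This is (2^a - 1)(2^b - 1) ≥ 0, multiplied out.
  2^+2^≤1+2^+ : ∀ a b → 2 ^ a + 2 ^ b ≤ 1 + 2 ^ (a + b)
  2^+2^≤1+2^+ a b = subst (λ z → 2 ^ a + 2 ^ b ≤ 1 + z) (≡.sym (^-distribˡ-+-* 2 a b))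
    (lem (2 ^ a) (2 ^ b) (m^n>0 2 a) (m^n>0 2 b))
    where
    lem : ∀ m n → 1 ≤ m → 1 ≤ n → m + n ≤ 1 + m * n
    lem (suc m) (suc n) _ _ = begin
      suc m + suc n             ≤⟨ m≤m+n _ (m * n) ⟩
      suc m + suc n + m * n     ≡⟨ eq m n ⟩
      1 + suc m * suc n         ∎
      where
      open ≤-Reasoning
      eq : ∀ m n → suc m + suc n + m * n ≡ 1 + suc m * suc n
      eq = solve-∀

  -- Convexity: replacing two exponents by their sum and 0 never lowers the sum of the powers, so
  -- the extreme case puts the whole exponent on a single element. The 1 on the left avoids a
  -- subtraction and lets the empty list start the induction.
  ∑-2^ : (xs : List A) (a : A → ℕ) → 1 + ∑ xs (λ x → 2 ^ a x) ≤ length xs + 2 ^ ∑ xs a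
  ∑-2^ []       a = ≤-refl
  ∑-2^ (x ∷ xs) a = begin
    1 + (2 ^ a x + ∑ xs (λ y → 2 ^ a y))   ≡⟨ lem (2 ^ a x) _ ⟩
    2 ^ a x + (1 + ∑ xs (λ y → 2 ^ a y))   ≤⟨ +-monoʳ-≤ (2 ^ a x) (∑-2^ xs a) ⟩
    2 ^ a x + (length xs + 2 ^ ∑ xs a)     ≡⟨ lem′ (2 ^ a x) (length xs) _ ⟩
    length xs + (2 ^ a x + 2 ^ ∑ xs a)     ≤⟨ +-monoʳ-≤ (length xs) (2^+2^≤1+2^+ (a x) (∑ xs a)) ⟩
    length xs + (1 + 2 ^ ∑ (x ∷ xs) a)     ≡⟨ +-suc (length xs) _ ⟩
    suc (length xs) + 2 ^ ∑ (x ∷ xs) a     ∎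
    where
    open ≤-Reasoning
    lem : ∀ p q → 1 + (p + q) ≡ p + (1 + q)
    lem = solve-∀
    lem′ : ∀ p q r → p + (q + r) ≡ q + (p + r)
    lem′ = solve-∀

  -- Sums over all subsets

  ∑-allSubsets-suc : (f : Vec Bool (suc s) → ℕ) →
    ∑ (allSubsets (suc s)) f ≡ ∑ (allSubsets s) (λ I → f (true Vec.∷ I) + f (false Vec.∷ I))
  ∑-allSubsets-suc {s} f = go (allSubsets s)
    where
    go : (Is : List (Vec Bool s)) →
      ∑ (concatMap (λ I → (true Vec.∷ I) ∷ (false Vec.∷ I) ∷ []) Is) f
        ≡ ∑ Is (λ I → f (true Vec.∷ I) + f (false Vec.∷ I))
    go []       = refl
    go (I ∷ Is) = ≡.trans (cong (λ z → f (true Vec.∷ I) + (f (false Vec.∷ I) + z)) (go Is))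
                          (≡.sym (+-assoc (f (true Vec.∷ I)) _ _))

  ∑-allSubsets-one : ∀ s → ∑ (allSubsets s) (λ _ → 1) ≡ 2 ^ s
  ∑-allSubsets-one zero    = refl
  ∑-allSubsets-one (suc s) = begin
    ∑ (allSubsets (suc s)) (λ _ → 1)   ≡⟨ ∑-allSubsets-suc {s} (λ _ → 1) ⟩
    ∑ (allSubsets s) (λ _ → 2 * 1)     ≡⟨ ∑-*ˡ (allSubsets s) 2 (λ _ → 1) ⟩
    2 * ∑ (allSubsets s) (λ _ → 1)     ≡⟨ cong (2 *_) (∑-allSubsets-one s) ⟩
    2 ^ suc s                          ∎
    where open ≡-Reasoning

  ∏-allFin-suc : (f : Fin (suc s) → ℕ) → ∏ (allFin (suc s)) f ≡ f zero * ∏ (allFin s) (f ∘ suc)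
  ∏-allFin-suc f = cong (λ fs → f zero * product fs)
    (≡.trans (map-tabulate suc f) (≡.sym (map-tabulate (λ i → i) (f ∘ suc))))

  -- Expanding the product of two-term sums gives one term per subset: membership of `i` selects the
  -- summand taken from factor `i`. Counting sets described vertex by vertex thus reduces to a
  -- product of local counts.
  ∑∏-distrib : (w : Fin s → Bool → ℕ) →
    ∑ (allSubsets s) (λ I → ∏ (allFin s) (λ i → w i (lookup I i)))
      ≡ ∏ (allFin s) (λ i → w i true + w i false)
  ∑∏-distrib {zero}  w = refl
  ∑∏-distrib {suc s} w = begin
    ∑ (allSubsets (suc s)) (λ I → ∏ (allFin (suc s)) (λ i → w i (lookup I i)))
      ≡⟨ ∑-allSubsets-suc (λ I → ∏ (allFin (suc s)) (λ i → w i (lookup I i))) ⟩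
    ∑ (allSubsets s) (λ I → ∏ (allFin (suc s)) (λ i → w i (lookup (true Vec.∷ I) i))
                          + ∏ (allFin (suc s)) (λ i → w i (lookup (false Vec.∷ I) i)))
      ≡⟨ ∑-cong (allSubsets s) (λ I → cong₂ _+_
           (∏-allFin-suc (λ i → w i (lookup (true Vec.∷ I) i)))
           (∏-allFin-suc (λ i → w i (lookup (false Vec.∷ I) i)))) ⟩
    ∑ (allSubsets s) (λ I → w zero true * rest I + w zero false * rest I)
      ≡⟨ ∑-cong (allSubsets s) (λ I → ≡.sym (*-distribʳ-+ (rest I) (w zero true) _)) ⟩
    ∑ (allSubsets s) (λ I → (w zero true + w zero false) * rest I)
      ≡⟨ ∑-*ˡ (allSubsets s) (w zero true + w zero false) rest ⟩
    (w zero true + w zero false) * ∑ (allSubsets s) rest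
      ≡⟨ cong ((w zero true + w zero false) *_) (∑∏-distrib (w ∘ suc)) ⟩
    (w zero true + w zero false) * ∏ (allFin s) (λ i → w (suc i) true + w (suc i) false)
      ≡⟨ ∏-allFin-suc (λ i → w i true + w i false) ⟨
    ∏ (allFin (suc s)) (λ i → w i true + w i false) ∎
    where
    open ≡-Reasoning
    rest : Vec Bool s → ℕ
    rest I = ∏ (allFin s) (λ i → w (suc i) (lookup I i))

  flip : Fin s → Vec Bool s → Vec Bool s
  flip n I = updateAt I n not

  ∑-flip : (n : Fin s) (f : Vec Bool s → ℕ) → ∑ (allSubsets s) (f ∘ flip n) ≡ ∑ (allSubsets s) f
  ∑-flip {suc s} zero f = begin
    ∑ (allSubsets (suc s)) (f ∘ flip zero)
      ≡⟨ ∑-allSubsets-suc (f ∘ flip zero) ⟩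
    ∑ (allSubsets s) (λ I → f (false Vec.∷ I) + f (true Vec.∷ I))
      ≡⟨ ∑-cong (allSubsets s) (λ I → +-comm (f (false Vec.∷ I)) _) ⟩
    ∑ (allSubsets s) (λ I → f (true Vec.∷ I) + f (false Vec.∷ I))
      ≡⟨ ∑-allSubsets-suc f ⟨
    ∑ (allSubsets (suc s)) f ∎
    where open ≡-Reasoning
  ∑-flip {suc s} (suc n) f = begin
    ∑ (allSubsets (suc s)) (f ∘ flip (suc n))
      ≡⟨ ∑-allSubsets-suc (f ∘ flip (suc n)) ⟩
    ∑ (allSubsets s) (λ I → f (true Vec.∷ flip n I) + f (false Vec.∷ flip n I))
      ≡⟨ ∑-flip n (λ I → f (true Vec.∷ I) + f (false Vec.∷ I)) ⟩
    ∑ (allSubsets s) (λ I → f (true Vec.∷ I) + f (false Vec.∷ I))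
      ≡⟨ ∑-allSubsets-suc f ⟨
    ∑ (allSubsets (suc s)) f ∎
    where open ≡-Reasoning

  -- A pairing argument: `flip n` permutes the subsets, so `f` and `f ∘ flip n` have the same sum,
  -- and it suffices to bound `f` on each pair consisting of a set and its toggled partner.
  2∑≤∑-by-flip : (n : Fin s) (f g : Vec Bool s → ℕ) → (∀ I → f I + f (flip n I) ≤ g I) →
    2 * ∑ (allSubsets s) f ≤ ∑ (allSubsets s) g
  2∑≤∑-by-flip {s} n f g f+f≤g = begin
    2 * ∑ (allSubsets s) f                                 ≡⟨ cong (∑ (allSubsets s) f +_) (+-identityʳ _) ⟩
    ∑ (allSubsets s) f + ∑ (allSubsets s) f                ≡⟨ cong (∑ (allSubsets s) f +_) (∑-flip n f) ⟨
    ∑ (allSubsets s) f + ∑ (allSubsets s) (f ∘ flip n)     ≡⟨ ∑-+ (allSubsets s) f (f ∘ flip n) ⟨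
    ∑ (allSubsets s) (λ I → f I + f (flip n I))            ≤⟨ ∑-mono (allSubsets s) (λ {I} _ → f+f≤g I) ⟩
    ∑ (allSubsets s) g                                     ∎
    where open ≤-Reasoning

  -- Independent sets and minimum degrees

  and-∈ : {b : Bool} (bs : List Bool) → and bs ≡ true → b ∈ bs → b ≡ true
  and-∈ (true ∷ bs) eq (here refl) = refl
  and-∈ (true ∷ bs) eq (there b∈)  = and-∈ bs eq b∈

  ∈-members : (I : Vec Bool s) {v : Fin s} → lookup I v ≡ true → v ∈ members I
  ∈-members I {v} v∈I = ∈-filter⁺ (λ u → lookup I u Bool.≟ true) (∈-allFin v) v∈I

  members-∈ : (I : Vec Bool s) {v : Fin s} → v ∈ members I → lookup I v ≡ true
  members-∈ {s} I v∈ = proj₂ (∈-filter⁻ (λ u → lookup I u Bool.≟ true) {xs = allFin s} v∈)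

  nonadjacent : (R : Graph s) (I : Vec Bool s) {u v : Fin s} → independent R I ≡ true →
    lookup I u ≡ true → lookup I v ≡ true → adj R u v ≡ false
  nonadjacent R I {u} {v} ind u∈I v∈I = not-true (and-∈ _ ind
    (∈-concatMap⁺ (λ x → map (λ y → not (adj R x y)) (members I))
      (Any.map (λ { refl → ∈-map⁺ (λ y → not (adj R u y)) (∈-members I v∈I) }) (∈-members I u∈I))))
    where
    not-true : ∀ {b} → not b ≡ true → b ≡ false
    not-true {false} _ = refl

  minList-∈ : (m : ℕ) (ms : List ℕ) → minList (m ∷ ms) ∈ m ∷ ms
  minList-∈ m ms with foldr-selective ⊓-sel m ms
  ... | inj₁ eq = here eq
  ... | inj₂ ∈ms = there ∈ms

  minList-≤ : {m : ℕ} (ms : List ℕ) → m ∈ ms → minList ms ≤ m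
  -- The head of the list is the start value of the fold, so it needs an induction of its own.
  minList-≤ (n ∷ ns) (here refl) = init ns
    where
    init : ∀ ns → foldr _⊓_ n ns ≤ n
    init []       = ≤-refl
    init (k ∷ ks) = ≤-trans (m⊓n≤n k _) (init ks)
  minList-≤ (n ∷ ns) (there m∈) = go m∈
    where
    go : ∀ {m ns} → m ∈ ns → foldr _⊓_ n ns ≤ m
    go (here refl) = m⊓n≤m _ _
    go (there m∈)  = ≤-trans (m⊓n≤n _ _) (go m∈)

  δ-≤ : (R : Graph s) (I : Vec Bool s) {v : Fin s} → lookup I v ≡ true → δ R I ≤ deg R v
  δ-≤ R I v∈I = minList-≤ (map (deg R) (members I)) (∈-map⁺ (deg R) (∈-members I v∈I))

  nonempty-members : (I : Vec Bool s) → nonempty I ≡ true → ∃₂ λ x xs → members I ≡ x ∷ xs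
  nonempty-members I ne with members I
  ... | x ∷ xs = x , xs , refl

  δ-attained : (R : Graph s) (I : Vec Bool s) → nonempty I ≡ true →
    ∃ λ x → lookup I x ≡ true × δ R I ≡ deg R x
  δ-attained R I ne with nonempty-members I ne
  ... | y , ys , eq with ∈-map⁻ (deg R) (minList-∈ (deg R y) (map (deg R) ys))
  ...   | x , x∈ , min≡ =
    x , members-∈ I (subst (x ∈_) (≡.sym eq) x∈)
      , ≡.trans (cong (minList ∘ map (deg R)) eq) min≡

  -- Leaves and their neighbours

  isLeaf : Graph s → Fin s → Bool
  isLeaf R v = does (deg R v ≟ 1)

  leaf-deg : (R : Graph s) (v : Fin s) → isLeaf R v ≡ true → deg R v ≡ 1
  leaf-deg R v leaf = ≡ᵇ⇒≡ (deg R v) 1 (subst Bool.T (≡.sym leaf) _)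

  deg-leaf : (R : Graph s) (v : Fin s) → deg R v ≢ 1 → isLeaf R v ≡ false
  deg-leaf R v d≢1 = dec-false (deg R v ≟ 1) d≢1

  leaves : Graph s → List (Fin s)
  leaves {s} R = filter (λ v → deg R v ≟ 1) (allFin s)

  core : Graph s → List (Fin s)
  core {s} R = filter (λ v → ¬? (deg R v ≟ 1)) (allFin s)

  numDegOne+core : (R : Graph s) → numDegOne R + length (core R) ≡ s
  numDegOne+core {s} R = begin
    length (leaves R) + length (core R)
      ≡⟨ cong₂ _+_ (length-filter-𝟙 (λ v → deg R v ≟ 1) (allFin s))
                   (length-filter-𝟙 (λ v → ¬? (deg R v ≟ 1)) (allFin s)) ⟩
    ∑ (allFin s) (λ v → 𝟙 (isLeaf R v)) + ∑ (allFin s) (λ v → 𝟙 (not (isLeaf R v)))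
      ≡⟨ ∑-+ (allFin s) _ _ ⟨
    ∑ (allFin s) (λ v → 𝟙 (isLeaf R v) + 𝟙 (not (isLeaf R v)))
      ≡⟨ ∑-cong (allFin s) (λ v → 𝟙-+-not (isLeaf R v)) ⟩
    ∑ (allFin s) (λ _ → 1)
      ≡⟨ ∑-one (allFin s) ⟩
    length (allFin s)
      ≡⟨ length-tabulate (λ i → i) ⟩
    s ∎
    where
    open ≡-Reasoning
    𝟙-+-not : ∀ b → 𝟙 b + 𝟙 (not b) ≡ 1
    𝟙-+-not true  = refl
    𝟙-+-not false = refl

  leaf-neighbour : (R : Graph s) {v : Fin s} → deg R v ≡ 1 → ∃ λ u → adj R v u ≡ true
  leaf-neighbour {s} R {v} d≡1 = ∑-𝟙-positive (allFin s) (adj R v) (λ d≡0 → 1≢0 (≡.trans (≡.sym d≡1) d≡0))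
    where
    1≢0 : 1 ≢ 0
    1≢0 ()

  leaf-neighbour-unique : (R : Graph s) {v u w : Fin s} → deg R v ≡ 1 →
    adj R v u ≡ true → adj R v w ≡ true → u ≡ w
  leaf-neighbour-unique R {v} {u} {w} d≡1 vu vw with u Fin.≟ w
  ... | yes u≡w = u≡w
  -- Two distinct neighbours already contribute 2 to the degree sum.
  ... | no  u≢w = contradiction
    (≤-trans (≤-reflexive (≡.sym (cong₂ (λ a b → 𝟙 a + 𝟙 b) vu vw)))
             (≤-trans (∑-∈₂ (𝟙 ∘ adj R v) u≢w (∈-allFin u) (∈-allFin w)) (≤-reflexive d≡1)))
    (λ { (s≤s ()) })

  adjacent-distinct : (R : Graph s) {u v : Fin s} → adj R u v ≡ true → u ≢ v
  adjacent-distinct R {u} uv refl with ≡.trans (≡.sym uv) (irrefl R u)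
  ... | ()

  -- Each of two adjacent leaves is the only neighbour of the other, so a walk that starts in the
  -- pair never leaves it. Through this, the exclusion of K₂ components says that no neighbour of a
  -- leaf is a leaf.
  adjacent-leaves-K₂ : (R : Graph s) {v u : Fin s} → adj R v u ≡ true →
    deg R v ≡ 1 → deg R u ≡ 1 → ComponentIsoK R v 2
  adjacent-leaves-K₂ {s} R {v} {u} vu dv du = f , injective , covers , reaches , complete
    where
    uv : adj R u v ≡ true
    uv = ≡.trans (sym R u v) vu

    f : Fin 2 → Fin s
    f zero       = v
    f (suc zero) = u

    v≢u : v ≢ u
    v≢u = adjacent-distinct R vu

    injective : ∀ {i j} → f i ≡ f j → i ≡ j
    injective {zero}     {zero}     _  = refl
    injective {zero}     {suc zero} eq = contradiction eq v≢u
    injective {suc zero} {zero}     eq = contradiction (≡.sym eq) v≢u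
    injective {suc zero} {suc zero} _  = refl

    closed : ∀ {x w} → Reachable R x w → (∃ λ i → f i ≡ x) → ∃ λ i → f i ≡ w
    closed here                hit            = hit
    closed (step xy reach) (zero , refl)     = closed reach (suc zero , leaf-neighbour-unique R dv vu xy)
    closed (step xy reach) (suc zero , refl) = closed reach (zero , leaf-neighbour-unique R du uv xy)

    covers : ∀ w → Reachable R v w → ∃ λ i → f i ≡ w
    covers w reach = closed reach (zero , refl)

    reaches : ∀ i → Reachable R v (f i)
    reaches zero       = here
    reaches (suc zero) = step vu here

    complete : ∀ i j → (adj R (f i) (f j) ≡ true → i ≢ j) × (i ≢ j → adj R (f i) (f j) ≡ true)
    complete i j = (λ adjacent i≡j → adjacent-distinct R adjacent (cong f i≡j)) , edge i j
      where
      edge : ∀ i j → i ≢ j → adj R (f i) (f j) ≡ true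
      edge zero       zero       i≢j = contradiction refl i≢j
      edge zero       (suc zero) _   = vu
      edge (suc zero) zero       _   = uv
      edge (suc zero) (suc zero) i≢j = contradiction refl i≢j

  -- Independent sets meeting the leaves

  lookup-flip : {v n : Fin s} → v ≢ n → (I : Vec Bool s) → lookup (flip n I) v ≡ lookup I v
  lookup-flip v≢n I = lookup∘updateAt′ _ _ v≢n I

  any-flip : (n : Fin s) (I : Vec Bool s) {ls : List (Fin s)} → All (_≢ n) ls →
    any (lookup (flip n I)) ls ≡ any (lookup I) ls
  any-flip n I ls≢n = cong or (map-cong-local (All.map (λ v≢n → lookup-flip v≢n I) ls≢n))

  -- Toggling the neighbour `n` of `v` preserves both the membership of `v` and the trace on `ls`,
  -- while at most one set of each toggled pair is independent.
  leaf-halves : (R : Graph s) {v n : Fin s} {ls : List (Fin s)} → adj R v n ≡ true → All (_≢ n) ls →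
    2 * ∑ (allSubsets s) (λ I → 𝟙 (not (any (lookup I) ls) ∧ lookup I v ∧ independent R I))
      ≤ ∑ (allSubsets s) (λ I → 𝟙 (not (any (lookup I) ls) ∧ lookup I v))
  leaf-halves {s} R {v} {n} {ls} vn ls≢n = 2∑≤∑-by-flip n _ _ pointwise
    where
    -- Whichever of `I` and `flip n I` contains `n` also contains its neighbour `v`, hence is
    -- dependent.
    not-both : (I : Vec Bool s) → lookup I v ≡ true →
      𝟙 (independent R I) + 𝟙 (independent R (flip n I)) ≤ 1
    not-both I v∈I with independent R I in indI | independent R (flip n I) in indF
    ... | false | false = z≤n
    ... | false | true  = ≤-refl
    ... | true  | false = ≤-refl
    ... | true  | true  with lookup I n in n∈I
    ...   | true  = contradiction (≡.trans (≡.sym vn) (nonadjacent R I indI v∈I n∈I)) λ ()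
    ...   | false = contradiction (≡.trans (≡.sym vn) (nonadjacent R (flip n I) indF
                      (≡.trans (lookup-flip (adjacent-distinct R vn) I) v∈I)
                      (≡.trans (lookup∘updateAt n I) (cong not n∈I)))) λ ()

    pointwise : (I : Vec Bool s) →
      𝟙 (not (any (lookup I) ls) ∧ lookup I v ∧ independent R I)
        + 𝟙 (not (any (lookup (flip n I)) ls) ∧ lookup (flip n I) v ∧ independent R (flip n I))
        ≤ 𝟙 (not (any (lookup I) ls) ∧ lookup I v)
    pointwise I rewrite any-flip n I ls≢n | lookup-flip (adjacent-distinct R vn) I
      with any (lookup I) ls | lookup I v in v∈I
    ... | true  | _     = z≤n
    ... | false | false = z≤n
    ... | false | true  = not-both I v∈I

  -- Induction over the list of leaves, which sorts the sets by the last listed leaf they contain.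
  -- The second sum counts the sets not sorted yet: a new leaf `v` removes those containing `v`, and
  -- these pay for twice the number of independent sets among them.
  meeting-bound : (R : Graph s) → (∀ {v u} → adj R v u ≡ true → deg R v ≡ 1 → deg R u ≢ 1) →
    {ls : List (Fin s)} → All (λ v → deg R v ≡ 1) ls →
    2 * ∑ (allSubsets s) (λ I → 𝟙 (any (lookup I) ls ∧ independent R I))
      + ∑ (allSubsets s) (λ I → 𝟙 (not (any (lookup I) ls))) ≤ 2 ^ s
  meeting-bound {s} R noK₂ {[]} [] = ≤-reflexive (begin
    2 * ∑ (allSubsets s) (λ _ → 0) + ∑ (allSubsets s) (λ _ → 1)
      ≡⟨ cong₂ (λ a b → 2 * a + b) (∑-zero (allSubsets s)) (∑-allSubsets-one s) ⟩
    2 ^ s ∎)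
    where open ≡-Reasoning
  meeting-bound {s} R noK₂ {v ∷ ls} (dv ∷ dls) with leaf-neighbour R dv
  ... | n , vn = begin
    2 * ∑ Is (λ I → 𝟙 ((lookup I v ∨ meets I) ∧ independent R I))
      + ∑ Is (λ I → 𝟙 (not (lookup I v ∨ meets I)))
      ≡⟨ cong (λ a → 2 * a + ∑ Is (λ I → 𝟙 (not (lookup I v ∨ meets I)))) (≡.trans
           (∑-cong Is (λ I → split-meets (lookup I v) (meets I) (independent R I)))
           (∑-+ Is _ _)) ⟩
    2 * (∑ Is (λ I → 𝟙 (meets I ∧ independent R I))
          + ∑ Is (λ I → 𝟙 (not (meets I) ∧ lookup I v ∧ independent R I)))
      + ∑ Is (λ I → 𝟙 (not (lookup I v ∨ meets I)))
      ≡⟨ lem (∑ Is (λ I → 𝟙 (meets I ∧ independent R I))) _ _ ⟩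
    2 * ∑ Is (λ I → 𝟙 (meets I ∧ independent R I))
      + (2 * ∑ Is (λ I → 𝟙 (not (meets I) ∧ lookup I v ∧ independent R I))
          + ∑ Is (λ I → 𝟙 (not (lookup I v ∨ meets I))))
      ≤⟨ +-monoʳ-≤ (2 * ∑ Is (λ I → 𝟙 (meets I ∧ independent R I)))
           (+-monoˡ-≤ (∑ Is (λ I → 𝟙 (not (lookup I v ∨ meets I))))
             -- If `n` were in `ls`, it would be a leaf adjacent to the leaf `v`.
             (leaf-halves R {ls = ls} vn (All.map (λ { du refl → noK₂ vn dv du }) dls))) ⟩
    2 * ∑ Is (λ I → 𝟙 (meets I ∧ independent R I))
      + (∑ Is (λ I → 𝟙 (not (meets I) ∧ lookup I v)) + ∑ Is (λ I → 𝟙 (not (lookup I v ∨ meets I))))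
      ≡⟨ cong (2 * ∑ Is (λ I → 𝟙 (meets I ∧ independent R I)) +_) (≡.trans
           (≡.sym (∑-+ Is _ _)) (∑-cong Is (λ I → split-avoids (lookup I v) (meets I)))) ⟩
    2 * ∑ Is (λ I → 𝟙 (meets I ∧ independent R I)) + ∑ Is (λ I → 𝟙 (not (meets I)))
      ≤⟨ meeting-bound R noK₂ dls ⟩
    2 ^ s ∎
    where
    open ≤-Reasoning
    Is : List (Vec Bool s)
    Is = allSubsets s
    meets : Vec Bool s → Bool
    meets I = any (lookup I) ls
    lem : ∀ a b c → 2 * (a + b) + c ≡ 2 * a + (2 * b + c)
    lem = solve-∀
    split-meets : ∀ a m i → 𝟙 ((a ∨ m) ∧ i) ≡ 𝟙 (m ∧ i) + 𝟙 (not m ∧ a ∧ i)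
    split-meets true  true  true  = refl
    split-meets true  true  false = refl
    split-meets true  false _     = refl
    split-meets false true  true  = refl
    split-meets false true  false = refl
    split-meets false false _     = refl
    split-avoids : ∀ a m → 𝟙 (not m ∧ a) + 𝟙 (not (a ∨ m)) ≡ 𝟙 (not m)
    split-avoids true  true  = refl
    split-avoids true  false = refl
    split-avoids false true  = refl
    split-avoids false false = refl

  -- The indicator is a product of vertex weights. A leaf can only be left out, a core vertex can be
  -- taken or left out, so the local counts are 1 and 2.
  avoiding-count : (R : Graph s) →
    ∑ (allSubsets s) (λ I → 𝟙 (not (any (lookup I) (leaves R)))) ≡ 2 ^ length (core R)
  avoiding-count {s} R = begin
    ∑ (allSubsets s) (λ I → 𝟙 (not (any (lookup I) (leaves R))))
      ≡⟨ ∑-cong (allSubsets s) (λ I → as-product I (allFin s)) ⟩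
    ∑ (allSubsets s) (λ I → ∏ (allFin s) (λ i → avoid i (lookup I i)))
      ≡⟨ ∑∏-distrib avoid ⟩
    ∏ (allFin s) (λ i → avoid i true + avoid i false)
      ≡⟨ cong product (map-cong (λ i → factor (isLeaf R i)) (allFin s)) ⟩
    ∏ (allFin s) (λ i → 2 ^ 𝟙 (not (isLeaf R i)))
      ≡⟨ ∏-2^ (allFin s) _ ⟩
    2 ^ ∑ (allFin s) (λ i → 𝟙 (not (isLeaf R i)))
      ≡⟨ cong (2 ^_) (length-filter-𝟙 (λ v → ¬? (deg R v ≟ 1)) (allFin s)) ⟨
    2 ^ length (core R) ∎
    where
    open ≡-Reasoning
    avoid : Fin s → Bool → ℕ
    avoid i b = if b then 𝟙 (not (isLeaf R i)) else 1
    factor : ∀ l → 𝟙 (not l) + 1 ≡ 2 ^ 𝟙 (not l)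
    factor true  = refl
    factor false = refl
    as-product : (I : Vec Bool s) (xs : List (Fin s)) →
      𝟙 (not (any (lookup I) (filter (λ v → deg R v ≟ 1) xs))) ≡ ∏ xs (λ i → avoid i (lookup I i))
    as-product I []       = refl
    as-product I (x ∷ xs) with isLeaf R x
    as-product I (x ∷ xs) | true with lookup I x
    ... | true  = refl
    ... | false = ≡.trans (as-product I xs) (≡.sym (+-identityʳ _))
    as-product I (x ∷ xs) | false with lookup I x
    ... | true  = ≡.trans (as-product I xs) (≡.sym (+-identityʳ _))
    ... | false = ≡.trans (as-product I xs) (≡.sym (+-identityʳ _))

  -- Independent sets avoiding the leaves, charged to a vertex of minimum degree

  -- The product of the weights charge R x i over i is the indicator of the sets that contain x
  -- and avoid both the leaves and the neighbours of x, provided x is not a leaf.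
  charge : Graph s → Fin s → Fin s → Bool → ℕ
  charge R x i b = if b then 𝟙 (not (isLeaf R i ∨ adj R x i)) else 𝟙 (not (does (i Fin.≟ x)))

  charges : (R : Graph s) → Fin s → Vec Bool s → ℕ
  charges {s} R x I = ∏ (allFin s) (λ i → charge R x i (lookup I i))

  leafDeg : Graph s → Fin s → ℕ
  leafDeg {s} R x = ∑ (allFin s) (λ i → 𝟙 (isLeaf R i ∧ adj R x i))

  any-false : (I : Vec Bool s) {ls : List (Fin s)} {v : Fin s} →
    any (lookup I) ls ≡ false → v ∈ ls → lookup I v ≡ false
  any-false I {u ∷ ls} eq v∈ with lookup I u in u∉I
  any-false I {u ∷ ls} eq (here refl) | false = u∉I
  any-false I {u ∷ ls} eq (there v∈)  | false = any-false I eq v∈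

  any-true : (I : Vec Bool s) (ls : List (Fin s)) →
    any (lookup I) ls ≡ true → ∃ λ v → v ∈ ls × lookup I v ≡ true
  any-true I (u ∷ ls) eq with lookup I u in u∈I
  ... | true  = u , here refl , u∈I
  ... | false with any-true I ls eq
  ...   | v , v∈ls , v∈I = v , there v∈ls , v∈I

  -- All factors are positive: a member of `I` is neither a leaf nor, by independence, adjacent to
  -- `x`, and a non-member differs from `x`.
  1≤charges : (R : Graph s) (I : Vec Bool s) {x : Fin s} → any (lookup I) (leaves R) ≡ false →
    independent R I ≡ true → lookup I x ≡ true → 1 ≤ charges R x I
  1≤charges {s} R I {x} avoids ind x∈I = ∏-positive (allFin s) factor
    where
    factor : ∀ i → 1 ≤ charge R x i (lookup I i)
    factor i with lookup I i in i∈I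
    factor i | true rewrite nonadjacent R I ind x∈I i∈I with deg R i ≟ 1
    ... | yes d≡1 = contradiction (≡.trans (≡.sym i∈I)
                      (any-false I avoids (∈-filter⁺ (λ v → deg R v ≟ 1) (∈-allFin i) d≡1))) λ ()
    ... | no  d≢1 rewrite deg-leaf R i d≢1 = ≤-refl
    factor i | false with i Fin.≟ x
    ... | yes refl = contradiction (≡.trans (≡.sym x∈I) i∈I) λ ()
    ... | no  _    = ≤-refl

  -- A set containing a leaf has minimum degree at most 1, so its term is at most 1. In a nonempty
  -- independent set without leaves, a vertex of minimum degree lies in the core and its summand
  -- alone covers the term; the other summands only enlarge the bound.
  lossTerm-≤ : (R : Graph s) (I : Vec Bool s) →
    (if independent R I ∧ nonempty I then 2 ^ δ R I ∸ 1 else 0)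
      ≤ 𝟙 (any (lookup I) (leaves R) ∧ independent R I)
        + ∑ (core R) (λ x → 2 ^ deg R x * charges R x I)
  lossTerm-≤ {s} R I with independent R I in ind | nonempty I in ne
  ... | false | _     = z≤n
  ... | true  | false = z≤n
  ... | true  | true  with any (lookup I) (leaves R) in meets
  ...   | true  with any-true I (leaves R) meets
  ...     | v , v∈L , v∈I = ≤-trans (∸-monoˡ-≤ 1 (^-monoʳ-≤ 2 δ≤1)) (m≤m+n 1 _)
    where
    δ≤1 : δ R I ≤ 1
    δ≤1 = ≤-trans (δ-≤ R I v∈I)
            (≤-reflexive (proj₂ (∈-filter⁻ (λ u → deg R u ≟ 1) {xs = allFin s} v∈L)))
  lossTerm-≤ {s} R I | true | true | false with δ-attained R I ne
  ... | x , x∈I , δ≡d = begin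
    2 ^ δ R I ∸ 1                                    ≤⟨ m∸n≤m (2 ^ δ R I) 1 ⟩
    2 ^ δ R I                                        ≡⟨ cong (2 ^_) δ≡d ⟩
    2 ^ deg R x                                      ≡⟨ *-identityʳ _ ⟨
    2 ^ deg R x * 1                                  ≤⟨ *-monoʳ-≤ (2 ^ deg R x) (1≤charges R I meets ind x∈I) ⟩
    2 ^ deg R x * charges R x I                      ≤⟨ ∑-∈ (λ y → 2 ^ deg R y * charges R y I) x∈core ⟩
    ∑ (core R) (λ y → 2 ^ deg R y * charges R y I)   ∎
    where
    open ≤-Reasoning
    x∈core : x ∈ core R
    x∈core = ∈-filter⁺ (λ v → ¬? (deg R v ≟ 1)) (∈-allFin x) λ d≡1 →
      contradiction (≡.trans (≡.sym x∈I)
        (any-false I meets (∈-filter⁺ (λ v → deg R v ≟ 1) (∈-allFin x) d≡1))) λ ()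

  -- The bound 2^(c-1) · 2^ℓ(x), doubled. Everything becomes a product over the vertices: the
  -- leading 2 is placed at `i = x`, and `2 ^ deg R x` puts a 2 at each neighbour of `x`. The two
  -- sides are then compared factor by factor.
  charged-bound : (R : Graph s) {x : Fin s} → deg R x ≢ 1 →
    2 * (2 ^ deg R x * ∑ (allSubsets s) (charges R x)) ≤ 2 ^ length (core R) * 2 ^ leafDeg R x
  charged-bound {s} R {x} d≢1 = begin
    2 * (2 ^ deg R x * ∑ (allSubsets s) (charges R x))
      ≤⟨ *-monoˡ-≤ (2 ^ deg R x * ∑ (allSubsets s) (charges R x))
           (^-monoʳ-≤ 2 (≤-trans (≤-reflexive (≡.sym 𝟙x≡1)) (∑-∈ (λ i → 𝟙 (does (i Fin.≟ x))) (∈-allFin x)))) ⟩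
    2 ^ ∑ V (λ i → 𝟙 (does (i Fin.≟ x))) * (2 ^ deg R x * ∑ (allSubsets s) (charges R x))
      ≡⟨ cong₂ _*_ (∏-2^ V _) (cong₂ _*_ (∏-2^ V _) (≡.sym (∑∏-distrib (charge R x)))) ⟨
    ∏ V (λ i → 2 ^ 𝟙 (does (i Fin.≟ x))) *
      (∏ V (λ i → 2 ^ 𝟙 (adj R x i)) * ∏ V (λ i → charge R x i true + charge R x i false))
      ≡⟨ cong (∏ V (λ i → 2 ^ 𝟙 (does (i Fin.≟ x))) *_) (∏-* V _ _) ⟨
    ∏ V (λ i → 2 ^ 𝟙 (does (i Fin.≟ x))) *
      ∏ V (λ i → 2 ^ 𝟙 (adj R x i) * (charge R x i true + charge R x i false))
      ≡⟨ ∏-* V _ _ ⟨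
    ∏ V (λ i → 2 ^ 𝟙 (does (i Fin.≟ x)) * (2 ^ 𝟙 (adj R x i) * (charge R x i true + charge R x i false)))
      ≤⟨ ∏-mono V factor ⟩
    ∏ V (λ i → 2 ^ 𝟙 (not (isLeaf R i)) * 2 ^ 𝟙 (isLeaf R i ∧ adj R x i))
      ≡⟨ ∏-* V _ _ ⟩
    ∏ V (λ i → 2 ^ 𝟙 (not (isLeaf R i))) * ∏ V (λ i → 2 ^ 𝟙 (isLeaf R i ∧ adj R x i))
      ≡⟨ cong₂ _*_ (∏-2^ V _) (∏-2^ V _) ⟩
    2 ^ ∑ V (λ i → 𝟙 (not (isLeaf R i))) * 2 ^ leafDeg R x
      ≡⟨ cong (λ c → 2 ^ c * 2 ^ leafDeg R x) (length-filter-𝟙 (λ v → ¬? (deg R v ≟ 1)) V) ⟨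
    2 ^ length (core R) * 2 ^ leafDeg R x ∎
    where
    open ≤-Reasoning
    V : List (Fin s)
    V = allFin s
    𝟙x≡1 : 𝟙 (does (x Fin.≟ x)) ≡ 1
    𝟙x≡1 = cong 𝟙 (dec-true (x Fin.≟ x) refl)
    -- Both sides agree in every case. The vertex `x` is forced in, and the leading 2 restores its
    -- core factor. A neighbour of `x` is forced out; its 2 replaces the lost choice of a core
    -- vertex, and for a leaf it is the factor recorded by `leafDeg`. Among the other vertices, a
    -- leaf gives 1 and a core vertex 2.
    factor : ∀ i →
      2 ^ 𝟙 (does (i Fin.≟ x)) * (2 ^ 𝟙 (adj R x i) * (charge R x i true + charge R x i false))
        ≤ 2 ^ 𝟙 (not (isLeaf R i)) * 2 ^ 𝟙 (isLeaf R i ∧ adj R x i)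
    factor i with i Fin.≟ x
    ... | yes refl rewrite irrefl R x | deg-leaf R x d≢1 = ≤-refl
    ... | no  _    with isLeaf R i | adj R x i
    ...   | true  | true  = ≤-refl
    ...   | true  | false = ≤-refl
    ...   | false | true  = ≤-refl
    ...   | false | false = ≤-refl

  -- Double counting of pairs of a vertex and a leaf adjacent to it: seen from the leaf, there is
  -- only one such pair.
  ∑-leafDeg : (R : Graph s) → ∑ (core R) (leafDeg R) ≤ numDegOne R
  ∑-leafDeg {s} R = begin
    ∑ (core R) (leafDeg R)
      ≤⟨ ∑-filter-≤ (λ v → ¬? (deg R v ≟ 1)) (allFin s) (leafDeg R) ⟩
    ∑ (allFin s) (λ x → ∑ (allFin s) (λ i → 𝟙 (isLeaf R i ∧ adj R x i)))
      ≡⟨ ∑-swap (allFin s) (allFin s) _ ⟩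
    ∑ (allFin s) (λ i → ∑ (allFin s) (λ x → 𝟙 (isLeaf R i ∧ adj R x i)))
      ≤⟨ ∑-mono (allFin s) (λ {i} _ → at-most-one i) ⟩
    ∑ (allFin s) (λ i → 𝟙 (isLeaf R i))
      ≡⟨ length-filter-𝟙 (λ v → deg R v ≟ 1) (allFin s) ⟨
    numDegOne R ∎
    where
    open ≤-Reasoning
    at-most-one : ∀ i → ∑ (allFin s) (λ x → 𝟙 (isLeaf R i ∧ adj R x i)) ≤ 𝟙 (isLeaf R i)
    at-most-one i with isLeaf R i in leaf
    ... | false = ≤-reflexive (∑-zero (allFin s))
    -- After `sym`, the sum over `x` is the degree of the leaf `i`.
    ... | true  = ≤-reflexive (≡.trans (∑-cong (allFin s) (λ x → cong 𝟙 (sym R x i))) (leaf-deg R i leaf))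

  -- Multiplying the convexity bound c - 1 + 2^ℓ by 2^c turns its -1 into the `2 ^ length (core R)`
  -- on the left, and 2^ℓ · 2^c into `2 ^ s`.
  avoiding-bound : (R : Graph s) →
    2 ^ length (core R) + 2 * ∑ (allSubsets s) (λ I → ∑ (core R) (λ x → 2 ^ deg R x * charges R x I))
      ≤ length (core R) * 2 ^ length (core R) + 2 ^ s
  avoiding-bound {s} R = begin
    2 ^ c + 2 * ∑ Is (λ I → ∑ (core R) (λ x → 2 ^ deg R x * charges R x I))
      ≡⟨ cong (λ a → 2 ^ c + 2 * a) (∑-swap Is (core R) _) ⟩
    2 ^ c + 2 * ∑ (core R) (λ x → ∑ Is (λ I → 2 ^ deg R x * charges R x I))
      ≡⟨ cong (2 ^ c +_) (∑-*ˡ (core R) 2 _) ⟨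
    2 ^ c + ∑ (core R) (λ x → 2 * ∑ Is (λ I → 2 ^ deg R x * charges R x I))
      ≤⟨ +-monoʳ-≤ (2 ^ c) (∑-mono (core R) (λ {x} x∈core →
           ≤-trans (≤-reflexive (cong (2 *_) (∑-*ˡ Is (2 ^ deg R x) (charges R x))))
                   (charged-bound R (proj₂ (∈-filter⁻ (λ v → ¬? (deg R v ≟ 1)) {xs = allFin s} x∈core))))) ⟩
    2 ^ c + ∑ (core R) (λ x → 2 ^ c * 2 ^ leafDeg R x)
      ≡⟨ cong (2 ^ c +_) (∑-*ˡ (core R) (2 ^ c) _) ⟩
    2 ^ c + 2 ^ c * ∑ (core R) (λ x → 2 ^ leafDeg R x)
      ≡⟨ *-suc (2 ^ c) _ ⟨
    2 ^ c * (1 + ∑ (core R) (λ x → 2 ^ leafDeg R x))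
      ≤⟨ *-monoʳ-≤ (2 ^ c) (≤-trans (∑-2^ (core R) (leafDeg R))
           (+-monoʳ-≤ c (^-monoʳ-≤ 2 (∑-leafDeg R)))) ⟩
    2 ^ c * (c + 2 ^ numDegOne R)
      ≡⟨ lem (2 ^ c) c _ ⟩
    c * 2 ^ c + 2 ^ numDegOne R * 2 ^ c
      ≡⟨ cong (c * 2 ^ c +_) (^-distribˡ-+-* 2 (numDegOne R) c) ⟨
    c * 2 ^ c + 2 ^ (numDegOne R + c)
      ≡⟨ cong (λ n → c * 2 ^ c + 2 ^ n) (numDegOne+core R) ⟩
    c * 2 ^ c + 2 ^ s ∎
    where
    open ≤-Reasoning
    c : ℕ
    c = length (core R)
    Is : List (Vec Bool s)
    Is = allSubsets s
    lem : ∀ p q r → p * (q + r) ≡ q * p + r * p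
    lem = solve-∀

  -- The two copies of 2^c on the left have different origins: one counts the leaf-free sets, left
  -- out when the sets meeting the leaves are halved; the other is the saving from convexity in
  -- `avoiding-bound`.
  loss-bound : (R : Graph s) → (∀ v → ¬ ComponentIsoK R v 2) →
    2 * φ R + 2 * 2 ^ length (core R) ≤ 2 * 2 ^ s + length (core R) * 2 ^ length (core R)
  loss-bound {s} R noK₂ = begin
    2 * φ R + 2 * 2 ^ c
      ≤⟨ +-monoˡ-≤ (2 * 2 ^ c) (*-monoʳ-≤ 2 (∑-mono (allSubsets s) (λ {I} _ → lossTerm-≤ R I))) ⟩
    2 * ∑ (allSubsets s) (λ I → meeting I + avoiding I) + 2 * 2 ^ c
      ≡⟨ cong (λ a → 2 * a + 2 * 2 ^ c) (∑-+ (allSubsets s) meeting avoiding) ⟩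
    2 * (∑ (allSubsets s) meeting + ∑ (allSubsets s) avoiding) + 2 * 2 ^ c
      ≡⟨ lem (∑ (allSubsets s) meeting) (∑ (allSubsets s) avoiding) (2 ^ c) ⟩
    (2 * ∑ (allSubsets s) meeting + 2 ^ c) + (2 ^ c + 2 * ∑ (allSubsets s) avoiding)
      ≤⟨ +-mono-≤ meeting≤ (avoiding-bound R) ⟩
    2 ^ s + (c * 2 ^ c + 2 ^ s)
      ≡⟨ lem′ (2 ^ s) (c * 2 ^ c) ⟩
    2 * 2 ^ s + c * 2 ^ c ∎
    where
    open ≤-Reasoning
    c : ℕ
    c = length (core R)
    meeting avoiding : Vec Bool s → ℕ
    meeting I = 𝟙 (any (lookup I) (leaves R) ∧ independent R I)
    avoiding I = ∑ (core R) (λ x → 2 ^ deg R x * charges R x I)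
    meeting≤ : 2 * ∑ (allSubsets s) meeting + 2 ^ c ≤ 2 ^ s
    meeting≤ = subst (λ n → 2 * ∑ (allSubsets s) meeting + n ≤ 2 ^ s) (avoiding-count R)
      (meeting-bound R (λ vu dv du → noK₂ _ (adjacent-leaves-K₂ R vu dv du))
        (all-filter (λ v → deg R v ≟ 1) (allFin s)))
    lem : ∀ p q r → 2 * (p + q) + 2 * r ≡ (2 * p + r) + (r + 2 * q)
    lem = solve-∀
    lem′ : ∀ p q → p + (q + p) ≡ 2 * p + q
    lem′ = solve-∀

-- Passage from natural numbers to integers.

open Counting using (core; numDegOne+core; loss-bound)
open import Data.Integer using (ℤ; +_; +≤+; -_; _+_; _-_; _*_; _≤_)
open import Data.Integer.Properties using (pos-+; pos-*; +-monoˡ-≤; module ≤-Reasoning)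
open import Data.Integer.Tactic.RingSolver using (solve-∀)
open import Data.List using (length)
import Data.Nat as ℕ
open import Data.Nat.Properties using (m+n∸m≡n)
open import Relation.Binary.PropositionalEquality using (refl; trans; cong; cong₂; subst₂) renaming (sym to ≡-sym)

-- Here `p`, `t`, `q` stand for φ, 2^s and 2^c. The coefficient s - ℓ - 2 = c - 2 can be negative,
-- as for a star with c = 1, so `2 * q` is moved across over the integers. Doubling turns the
-- exponent s - ℓ - 1 into s - ℓ = c.
doubled-bound : ∀ p t ℓ c q → 2 ℕ.* p ℕ.+ 2 ℕ.* q ℕ.≤ 2 ℕ.* t ℕ.+ c ℕ.* q →
  + 2 * + p ≤ + 2 * + t + (+ (ℓ ℕ.+ c) - + ℓ - + 2) * + q
doubled-bound p t ℓ c q le = begin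
  + 2 * + p                                        ≡⟨ cancel (+ p) (+ q) ⟩
  + 2 * + p + + 2 * + q + - (+ 2 * + q)            ≡⟨ cong (_+ - (+ 2 * + q)) (linear 2 p 2 q) ⟨
  + (2 ℕ.* p ℕ.+ 2 ℕ.* q) + - (+ 2 * + q)          ≤⟨ +-monoˡ-≤ (- (+ 2 * + q)) (+≤+ le) ⟩
  + (2 ℕ.* t ℕ.+ c ℕ.* q) + - (+ 2 * + q)          ≡⟨ cong (_+ - (+ 2 * + q)) (linear 2 t c q) ⟩
  + 2 * + t + + c * + q + - (+ 2 * + q)            ≡⟨ regroup (+ t) (+ ℓ) (+ c) (+ q) ⟩
  + 2 * + t + (+ ℓ + + c - + ℓ - + 2) * + q        ≡⟨ cong (λ n → + 2 * + t + (n - + ℓ - + 2) * + q) (pos-+ ℓ c) ⟨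
  + 2 * + t + (+ (ℓ ℕ.+ c) - + ℓ - + 2) * + q      ∎
  where
  open ≤-Reasoning
  linear : ∀ a b d e → + (a ℕ.* b ℕ.+ d ℕ.* e) ≡ + a * + b + + d * + e
  linear a b d e = trans (pos-+ (a ℕ.* b) (d ℕ.* e)) (cong₂ _+_ (pos-* a b) (pos-* d e))
  cancel : ∀ x y → + 2 * x ≡ + 2 * x + + 2 * y + - (+ 2 * y)
  cancel = solve-∀
  regroup : ∀ x l k y → + 2 * x + k * y + - (+ 2 * y) ≡ + 2 * x + (l + k - l - + 2) * y
  regroup = solve-∀

theorem4p8 : (s ℓ : ℕ) (R : Graph s) → numDegOne R ≡ ℓ →
    (∀ v → ¬ ComponentIsoK R v 1) → (∀ v → ¬ ComponentIsoK R v 2) →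
    + 2 * + φ R ≤ + 2 * + (2 ^ s) + (+ s - + ℓ - + 2) * + (2 ^ (s ∸ ℓ))
theorem4p8 s ℓ R refl _ noK₂ =
  subst₂ (λ n k → + 2 * + φ R ≤ + 2 * + (2 ^ s) + (+ n - + ℓ - + 2) * + (2 ^ k))
    (numDegOne+core R) core≡s∸ℓ
    (doubled-bound (φ R) (2 ^ s) ℓ (length (core R)) (2 ^ length (core R)) (loss-bound R noK₂))
  where
  -- The truncated subtraction is exact because ℓ + c = s.
  core≡s∸ℓ : length (core R) ≡ s ∸ ℓ
  core≡s∸ℓ = trans (≡-sym (m+n∸m≡n ℓ (length (core R)))) (cong (_∸ ℓ) (numDegOne+core R))
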